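{- (1) For all $k\ge1$ and $n\ge k$, the highest power of $x$ appearing in $Q_{n,132}^{(0,k,0,0)}(x)$ is $x^{n-k}$, and $Q_{n,132}^{(0,k,0,0)}(x)|_{x^{n-k}}=C_kC_{n-k}$. (2) For all $k\ge1$ and $n\ge k+1$, $Q_{n,132}^{(0,k,0,0)}(x)|_{x^{n-k-1}}=a_kC_{n-k}$, where $a_1=1$ and for $k\ge2$, $a_k=C_k+\sum_{i=1}^{k-1}C_{i-1}a_{k-i}$.
   Context: For $\sigma=\sigma_1\cdots\sigma_n\in S_n$, $\mathrm{mmp}^{(0,k,0,0)}(\sigma)$ is the number of positions $i$ such that there are at least $k$ indices $j<i$ with $\sigma_j>\sigma_i$. $S_n(132)$ is the set of 132-avoiding permutations of $[n]$. $Q_{n,132}^{(0,k,0,0)}(x)=\sum_{\sigma\in S_n(132)}x^{\mathrm{mmp}^{(0,k,0,0)}(\sigma)}$. $P(x)|_{x^r}$ is the coefficient of $x^r$. $C_n=\frac{1}{n+1}\binom{2n}{n}$. -}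

module Defs where

open import Data.Nat using (ℕ; zero; suc; _+_; _*_; _∸_; _<ᵇ_; _≤ᵇ_; _≡ᵇ_)
open import Data.Nat.Combinatorics using (_C_)
open import Data.Nat.DivMod using (_/_)
open import Data.Bool using (Bool; true; false; _∧_; _∨_; if_then_else_)
open import Data.List using (List; []; _∷_; map; concatMap)
open import Data.Bool.ListAction using (any)

Cat : ℕ → ℕ
Cat n = ((2 * n) C n) / suc n

insertions : ℕ → List ℕ → List (List ℕ)
insertions x [] = (x ∷ []) ∷ []
insertions x (y ∷ ys) = (x ∷ y ∷ ys) ∷ map (y ∷_) (insertions x ys)

-- S_n : all permutations of [n] = {1,…,n}, as words σ₁⋯σₙ (each exactly once)
perms : ℕ → List (List ℕ)
perms zero = [] ∷ []
perms (suc n) = concatMap (insertions (suc n)) (perms n)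

-- σ contains 132: positions i<j<l with σ_i < σ_l < σ_j
-- has32above b w : entries w_j, w_l of w (j<l) with b < w_l < w_j
has32above : ℕ → List ℕ → Bool
has32above b [] = false
has32above b (y ∷ ys) = ((b <ᵇ y) ∧ any (λ z → (b <ᵇ z) ∧ (z <ᵇ y)) ys) ∨ has32above b ys

contains132 : List ℕ → Bool
contains132 [] = false
contains132 (x ∷ xs) = has32above x xs ∨ contains132 xs

avoids132 : List ℕ → Bool
avoids132 σ = if contains132 σ then false else true

countGreater : ℕ → List ℕ → ℕ
countGreater v [] = 0
countGreater v (y ∷ ys) = (if v <ᵇ y then 1 else 0) + countGreater v ys

-- mmp^{(0,k,0,0)}: positions i with at least k indices j<i with σ_j > σ_i.
-- mmpAux k pre σ : pre is the (reversed) prefix already read.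
mmpAux : ℕ → List ℕ → List ℕ → ℕ
mmpAux k pre [] = 0
mmpAux k pre (x ∷ xs) = (if (k ≤ᵇ countGreater x pre) then 1 else 0) + mmpAux k (x ∷ pre) xs

mmp : ℕ → List ℕ → ℕ
mmp k σ = mmpAux k [] σ

countTrue : List Bool → ℕ
countTrue [] = 0
countTrue (b ∷ bs) = (if b then 1 else 0) + countTrue bs

Qcoeff : ℕ → ℕ → ℕ → ℕ
Qcoeff n k r = countTrue (map (λ σ → avoids132 σ ∧ (mmp k σ ≡ᵇ r)) (perms n))

-- Every τ ∈ S_{n+1}(132) factors uniquely as τ = (α + (n−i)) (n+1) β with
-- α ∈ S_i(132) and β ∈ S_{n−i}(132) (ΣAv-decomposition).  Since `perms` builds
-- S_{n+1} by inserting n+1 into the elements of S_n, this is proved by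
-- characterising the positions where n+1 can be inserted without creating a 132
-- (the admissible positions) and an induction peeling off the first block
-- (ΣAvAdm-concat).  Counting shows that |S_n(132)| satisfies Segner's recurrence,
-- hence equals the Catalan number, which is matched with the frozen
-- Cat n = C(2n,n)/(n+1) through the ballot numbers and their closed form.
-- On the factorisation the statistic splits as
--     mmp_k τ = mmp_k α + [k = 0] + mmp_{k−i−1} β          (mmp-concat),
-- giving a recursion for the coefficients (qcoeff-decomposition), from which the
-- top coefficient C_k C_{n−k} (qcoeff-top) and the next one a_k C_{n−k}
-- (qcoeff-subtop) follow by strong induction on k.

module Submission where

open import Defs
open import Data.Nat
open import Data.Nat.Properties
open import Data.Nat.Combinatorics using (_C_; nCk+nC[k+1]≡[n+1]C[k+1]; k>n⇒nCk≡0; nCn≡1; nC1≡n; nCk≡nC[n∸k])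
open import Data.Nat.DivMod using (_/_; m*n/n≡m)
open import Data.Nat.Induction using (<-rec)
open import Data.Nat.ListAction using (sum)
open import Data.Nat.Solver using (module +-*-Solver)
open import Data.Bool using (Bool; true; false; T; _∧_; _∨_; if_then_else_; not)
open import Data.Bool.Properties using (∨-assoc; ∨-comm; ∨-identityʳ; ∨-zeroʳ; ∧-identityʳ; ∧-comm)
open import Data.Bool.ListAction using (any)
open import Data.List using (List; []; _∷_; map; concatMap; _++_; _ʳ++_; length; drop; upTo; applyUpTo)
open import Data.List.Properties using (length-map; drop-map; map-upTo)
open import Data.List.Relation.Unary.All as All using (All; []; _∷_)
open import Data.List.Relation.Unary.All.Properties using (map⁺; concat⁺)
open import Data.Product using (_×_; _,_)
open import Data.Empty using (⊥-elim)
open import Data.Unit using (tt)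
open import Relation.Nullary using (¬_; yes; no)
open import Relation.Binary.PropositionalEquality

open +-*-Solver using (solve; _:+_; _:=_)

sumTo : ℕ → (ℕ → ℕ) → ℕ
sumTo zero f = 0
sumTo (suc n) f = f 0 + sumTo n (λ i → f (suc i))

+-interchange : ∀ a b c d → (a + b) + (c + d) ≡ (a + c) + (b + d)
+-interchange = solve 4 (λ a b c d → (a :+ b) :+ (c :+ d) := (a :+ c) :+ (b :+ d)) refl

sumTo-cong : ∀ n {f g : ℕ → ℕ} → (∀ i → i < n → f i ≡ g i) → sumTo n f ≡ sumTo n g
sumTo-cong zero h = refl
sumTo-cong (suc n) h = cong₂ _+_ (h 0 z<s) (sumTo-cong n (λ i i<n → h (suc i) (s<s i<n)))

sumTo-zero : ∀ n {f : ℕ → ℕ} → (∀ i → i < n → f i ≡ 0) → sumTo n f ≡ 0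
sumTo-zero zero h = refl
sumTo-zero (suc n) h = cong₂ _+_ (h 0 z<s) (sumTo-zero n (λ i i<n → h (suc i) (s<s i<n)))

sumTo-+ : ∀ n (f g : ℕ → ℕ) → sumTo n (λ i → f i + g i) ≡ sumTo n f + sumTo n g
sumTo-+ zero f g = refl
sumTo-+ (suc n) f g =
  trans (cong (f 0 + g 0 +_) (sumTo-+ n (λ i → f (suc i)) (λ i → g (suc i))))
        (+-interchange (f 0) (g 0) _ _)

sumTo-*ʳ : ∀ n (f : ℕ → ℕ) c → sumTo n (λ i → f i * c) ≡ sumTo n f * c
sumTo-*ʳ zero f c = refl
sumTo-*ʳ (suc n) f c = trans (cong (f 0 * c +_) (sumTo-*ʳ n (λ i → f (suc i)) c))
  (sym (*-distribʳ-+ c (f 0) _))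

sumTo-*ˡ : ∀ n (f : ℕ → ℕ) c → sumTo n (λ i → c * f i) ≡ c * sumTo n f
sumTo-*ˡ n f c = trans (sumTo-cong n (λ i _ → *-comm c (f i)))
  (trans (sumTo-*ʳ n f c) (*-comm (sumTo n f) c))

sumTo-last : ∀ n (f : ℕ → ℕ) → sumTo (suc n) f ≡ sumTo n f + f n
sumTo-last zero f = +-identityʳ (f 0)
sumTo-last (suc n) f = trans (cong (f 0 +_) (sumTo-last n (λ i → f (suc i))))
  (sym (+-assoc (f 0) _ _))

sumTo-split : ∀ a b (f : ℕ → ℕ) → sumTo (a + b) f ≡ sumTo a f + sumTo b (λ j → f (a + j))
sumTo-split zero b f = refl
sumTo-split (suc a) b f = trans (cong (f 0 +_) (sumTo-split a b (λ i → f (suc i))))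
  (sym (+-assoc (f 0) _ _))

sumTo-swap : ∀ a b (F : ℕ → ℕ → ℕ) →
  sumTo a (λ i → sumTo b (λ j → F i j)) ≡ sumTo b (λ j → sumTo a (λ i → F i j))
sumTo-swap zero b F = sym (sumTo-zero b (λ _ _ → refl))
sumTo-swap (suc a) b F = trans (cong (sumTo b (F 0) +_) (sumTo-swap a b (λ i → F (suc i))))
  (sym (sumTo-+ b (F 0) (λ j → sumTo a (λ i → F (suc i) j))))

sumTo-factorʳ : ∀ n (f g : ℕ → ℕ) c → sumTo n (λ i → f i * (g i * c)) ≡ sumTo n (λ i → f i * g i) * c
sumTo-factorʳ n f g c =
  trans (sumTo-cong n (λ i _ → sym (*-assoc (f i) (g i) c))) (sumTo-*ʳ n (λ i → f i * g i) c)

sum-map-upTo : ∀ m (g : ℕ → ℕ) → sum (map g (upTo m)) ≡ sumTo m g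
sum-map-upTo m g = trans (cong sum (map-upTo g m)) (go m g)
  where
  go : ∀ m (g : ℕ → ℕ) → sum (applyUpTo g m) ≡ sumTo m g
  go zero g = refl
  go (suc m) g = cong (g 0 +_) (go m (λ i → g (suc i)))

-- Cauchy convolution  (g ⋆ h) b = Σ_{i≤b} g i · h (b−i).
-- Note  (g ⋆ h) (suc b) = g 0 · h (suc b) + ((g ∘ suc) ⋆ h) b  holds definitionally.
_⋆_ : (ℕ → ℕ) → (ℕ → ℕ) → ℕ → ℕ
(g ⋆ h) b = sumTo (suc b) (λ i → g i * h (b ∸ i))

⋆-+ˡ : ∀ b (g₁ g₂ h : ℕ → ℕ) → ((λ i → g₁ i + g₂ i) ⋆ h) b ≡ (g₁ ⋆ h) b + (g₂ ⋆ h) b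
⋆-+ˡ b g₁ g₂ h = trans (sumTo-cong (suc b) (λ i _ → *-distribʳ-+ (h (b ∸ i)) (g₁ i) (g₂ i)))
  (sumTo-+ (suc b) (λ i → g₁ i * h (b ∸ i)) (λ i → g₂ i * h (b ∸ i)))

-- The ballot numbers, given by their recursion; `ballot-closed` below shows
-- ballot d b = C(d+2b, d+b) − C(d+2b, d+b+1), and ballot 0 b is the Catalan number.
ballot : ℕ → ℕ → ℕ
ballot zero zero = 1
ballot (suc d) zero = ballot d zero
ballot zero (suc b) = ballot 1 b
ballot (suc d) (suc b) = ballot d (suc b) + ballot (suc (suc d)) b

catalan : ℕ → ℕ
catalan = ballot 0

ballot-d0 : ∀ d → ballot d 0 ≡ 1
ballot-d0 zero = refl
ballot-d0 (suc d) = ballot-d0 d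

ballot-pos : ∀ d b → 1 ≤ ballot d b
ballot-pos zero zero = ≤-refl
ballot-pos (suc d) zero = ballot-pos d zero
ballot-pos zero (suc b) = ballot-pos 1 b
ballot-pos (suc d) (suc b) = ≤-trans (ballot-pos d (suc b)) (m≤m+n _ _)

-- First-return decomposition:  ballot (d+1) = ballot d ⋆ catalan.
ballot-⋆ : ∀ d b → ballot (suc d) b ≡ (ballot d ⋆ catalan) b
ballot-⋆ d zero = sym (trans (+-identityʳ _) (*-identityʳ _))
ballot-⋆ zero (suc b) = cong₂ _+_ (sym (+-identityʳ (catalan (suc b)))) (ballot-⋆ 1 b)
ballot-⋆ (suc d) (suc b) =
  trans (cong₂ _+_ (ballot-⋆ d (suc b)) (ballot-⋆ (suc (suc d)) b))
  (trans (+-assoc (ballot d 0 * catalan (suc b)) _ _)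
         (cong (ballot d 0 * catalan (suc b) +_)
               (sym (⋆-+ˡ b (λ i → ballot d (suc i)) (ballot (suc (suc d))) catalan))))

catalan-segner : ∀ b → catalan (suc b) ≡ (catalan ⋆ catalan) b
catalan-segner = ballot-⋆ 0

segner-unique : ∀ {u v : ℕ → ℕ} → u 0 ≡ v 0 →
  (∀ b → u (suc b) ≡ (u ⋆ u) b) → (∀ b → v (suc b) ≡ (v ⋆ v) b) → ∀ n → u n ≡ v n
segner-unique {u} {v} u0 us vs = <-rec (λ n → u n ≡ v n) step
  where
  step : ∀ n → (∀ {m} → m < n → u m ≡ v m) → u n ≡ v n
  step zero _ = u0
  step (suc b) ih = trans (us b) (trans (sumTo-cong (suc b) agree) (sym (vs b)))
    where
    agree : ∀ i → i < suc b → u i * u (b ∸ i) ≡ v i * v (b ∸ i)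
    agree i i≤b = cong₂ _*_ (ih (s≤s (≤-pred i≤b))) (ih (s≤s (m∸n≤m b i)))

pascal : ∀ n k → suc n C suc k ≡ n C k + n C suc k
pascal n k = sym (nCk+nC[k+1]≡[n+1]C[k+1] n k)

-- ballotN d b = d + 2b and ballotK d b = d + b, by the recursion on b that
-- matches `ballot`, so that the closed form can be proved without arithmetic.
ballotN : ℕ → ℕ → ℕ
ballotN d zero = d
ballotN d (suc b) = suc (suc (ballotN d b))

ballotK : ℕ → ℕ → ℕ
ballotK d zero = d
ballotK d (suc b) = suc (ballotK d b)

ballotN-suc : ∀ d b → ballotN (suc d) b ≡ suc (ballotN d b)
ballotN-suc d zero = refl
ballotN-suc d (suc b) = cong (λ x → suc (suc x)) (ballotN-suc d b)

ballotK-suc : ∀ d b → ballotK (suc d) b ≡ suc (ballotK d b)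
ballotK-suc d zero = refl
ballotK-suc d (suc b) = cong suc (ballotK-suc d b)

ballotN-0 : ∀ b → ballotN 0 b ≡ b + b
ballotN-0 zero = refl
ballotN-0 (suc b) = cong suc (trans (cong suc (ballotN-0 b)) (sym (+-suc b b)))

ballotK-0 : ∀ b → ballotK 0 b ≡ b
ballotK-0 zero = refl
ballotK-0 (suc b) = cong suc (ballotK-0 b)

closed-step-zero : ∀ x N K → x + suc N C suc (suc K) ≡ suc N C suc K → suc N C K ≡ suc N C suc K →
  x + suc (suc N) C suc (suc K) ≡ suc (suc N) C suc K
closed-step-zero x N K ih sym' rewrite pascal (suc N) (suc K) | pascal (suc N) K
  | sym (+-assoc x (suc N C suc K) (suc N C suc (suc K)))
  | +-comm x (suc N C suc K)
  | +-assoc (suc N C suc K) x (suc N C suc (suc K))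
  | ih | sym' = refl

closed-step-suc : ∀ x y N K → x + suc (suc N) C suc (suc K) ≡ suc (suc N) C suc K →
  y + suc (suc N) C suc (suc (suc K)) ≡ suc (suc N) C suc (suc K) →
  x + y + suc (suc (suc N)) C suc (suc (suc K)) ≡ suc (suc (suc N)) C suc (suc K)
closed-step-suc x y N K ih₁ ih₂ rewrite pascal (suc (suc N)) (suc (suc K))
  | pascal (suc (suc N)) (suc K)
  | +-interchange x y (suc (suc N) C suc (suc K)) (suc (suc N) C suc (suc (suc K)))
  | ih₁ | ih₂ = refl

central-symmetry : ∀ b → suc (ballotN 0 b) C ballotK 0 b ≡ suc (ballotN 0 b) C suc (ballotK 0 b)
central-symmetry b rewrite ballotN-0 b | ballotK-0 b =
  trans (nCk≡nC[n∸k] (≤-trans (m≤m+n b b) (n≤1+n _)))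
        (cong (suc (b + b) C_) (trans (+-∸-assoc 1 (m≤m+n b b)) (cong suc (m+n∸m≡n b b))))

ballot-closed : ∀ d b → ballot d b + ballotN d b C suc (ballotK d b) ≡ ballotN d b C ballotK d b
ballot-closed d zero rewrite ballot-d0 d | k>n⇒nCk≡0 (n<1+n d) | nCn≡1 d = refl
ballot-closed zero (suc b) =
  closed-step-zero (ballot 1 b) (ballotN 0 b) (ballotK 0 b)
    (subst₂ (λ x y → ballot 1 b + x C suc y ≡ x C y) (ballotN-suc 0 b) (ballotK-suc 0 b)
            (ballot-closed 1 b))
    (central-symmetry b)
ballot-closed (suc d) (suc b) =
  subst₂ (λ x y → ballot (suc d) (suc b) + suc (suc x) C suc (suc y) ≡ suc (suc x) C suc y)
    (sym (ballotN-suc d b)) (sym (ballotK-suc d b))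
    (closed-step-suc (ballot d (suc b)) (ballot (suc (suc d)) b) (ballotN d b) (ballotK d b)
      (ballot-closed d (suc b))
      (subst₂ (λ x y → ballot (suc (suc d)) b + x C suc y ≡ x C y)
        (trans (ballotN-suc (suc d) b) (cong suc (ballotN-suc d b)))
        (trans (ballotK-suc (suc d) b) (cong suc (ballotK-suc d b)))
        (ballot-closed (suc (suc d)) b)))

absorption : ∀ n k → suc k * (suc n C suc k) ≡ suc n * (n C k)
absorption zero zero = refl
absorption zero (suc k)
  rewrite k>n⇒nCk≡0 {1} {suc (suc k)} (s≤s (s≤s z≤n)) | k>n⇒nCk≡0 {0} {suc k} z<s =
  *-zeroʳ (suc (suc k))
absorption (suc n) zero rewrite nC1≡n (suc (suc n)) = trans (+-identityʳ _) (sym (*-identityʳ _))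
absorption (suc n) (suc k) =
  begin
    suc (suc k) * (suc (suc n) C suc (suc k))
  ≡⟨ cong (suc (suc k) *_) (pascal (suc n) (suc k)) ⟩
    suc (suc k) * (a + b)
  ≡⟨ *-distribˡ-+ (suc (suc k)) a b ⟩
    (a + suc k * a) + suc (suc k) * b
  ≡⟨ cong₂ (λ x y → (a + x) + y) (absorption n k) (absorption n (suc k)) ⟩
    (a + suc n * (n C k)) + suc n * (n C suc k)
  ≡⟨ +-assoc a _ _ ⟩
    a + (suc n * (n C k) + suc n * (n C suc k))
  ≡⟨ cong (a +_) (sym (*-distribˡ-+ (suc n) (n C k) (n C suc k))) ⟩
    a + suc n * (n C k + n C suc k)
  ≡⟨ cong (λ x → a + suc n * x) (sym (pascal n k)) ⟩
    suc (suc n) * a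
  ∎
  where
  open ≡-Reasoning
  a = suc n C suc k
  b = suc n C suc (suc k)

-- (b+1) · catalan b = C(2b, b): from the ballot formula with d = 0 and
-- absorption, which gives (b+1) · C(2b, b+1) = b · C(2b, b).
catalan-binomial : ∀ b → catalan b * suc b ≡ (b + b) C b
catalan-binomial zero = refl
catalan-binomial (suc b') = +-cancelʳ-≡ (b * Y) _ _ key
  where
  open ≡-Reasoning
  b = suc b'
  X = (b + b) C suc b
  Y = (b + b) C b
  ballot-0 : catalan b + X ≡ Y
  ballot-0 = subst₂ (λ x y → catalan b + x C suc y ≡ x C y) (ballotN-0 b) (ballotK-0 b)
                    (ballot-closed 0 b)
  symmetric : (b' + b) C b ≡ (b' + b) C b'
  symmetric = trans (nCk≡nC[n∸k] (m≤n+m b b')) (cong ((b' + b) C_) (m+n∸n≡m b' b))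
  absorbed : suc b * X ≡ b * Y
  absorbed = trans (absorption (b' + b) b)
    (trans (cong (suc (b' + b) *_) symmetric) (sym (absorption (b' + b) b')))
  key : catalan b * suc b + b * Y ≡ Y + b * Y
  key =
    begin
      catalan b * suc b + b * Y
    ≡⟨ cong₂ _+_ (*-comm (catalan b) (suc b)) (sym absorbed) ⟩
      suc b * catalan b + suc b * X
    ≡⟨ sym (*-distribˡ-+ (suc b) (catalan b) X) ⟩
      suc b * (catalan b + X)
    ≡⟨ cong (suc b *_) ballot-0 ⟩
      Y + b * Y
    ∎

Cat≡catalan : ∀ b → Cat b ≡ catalan b
Cat≡catalan b =
  trans (cong (λ x → (x C b) / suc b) (cong (b +_) (+-identityʳ b)))
  (trans (cong (_/ suc b) (sym (catalan-binomial b))) (m*n/n≡m (catalan b) (suc b)))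

sumOver : {A : Set} → List A → (A → ℕ) → ℕ
sumOver [] f = 0
sumOver (x ∷ xs) f = f x + sumOver xs f

sumOver-++ : {A : Set} (xs ys : List A) (f : A → ℕ) →
  sumOver (xs ++ ys) f ≡ sumOver xs f + sumOver ys f
sumOver-++ [] ys f = refl
sumOver-++ (x ∷ xs) ys f = trans (cong (f x +_) (sumOver-++ xs ys f)) (sym (+-assoc (f x) _ _))

sumOver-map : {A B : Set} (g : A → B) (xs : List A) (f : B → ℕ) →
  sumOver (map g xs) f ≡ sumOver xs (λ x → f (g x))
sumOver-map g [] f = refl
sumOver-map g (x ∷ xs) f = cong (f (g x) +_) (sumOver-map g xs f)

sumOver-concatMap : {A B : Set} (g : A → List B) (xs : List A) (f : B → ℕ) →
  sumOver (concatMap g xs) f ≡ sumOver xs (λ x → sumOver (g x) f)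
sumOver-concatMap g [] f = refl
sumOver-concatMap g (x ∷ xs) f =
  trans (sumOver-++ (g x) (concatMap g xs) f) (cong (sumOver (g x) f +_) (sumOver-concatMap g xs f))

sumOver-cong : {A : Set} {P : A → Set} (xs : List A) {f g : A → ℕ} →
  All P xs → (∀ x → P x → f x ≡ g x) → sumOver xs f ≡ sumOver xs g
sumOver-cong [] [] h = refl
sumOver-cong (x ∷ xs) (px ∷ pxs) h = cong₂ _+_ (h x px) (sumOver-cong xs pxs h)

sumOver-+ : {A : Set} (xs : List A) (f g : A → ℕ) →
  sumOver xs (λ x → f x + g x) ≡ sumOver xs f + sumOver xs g
sumOver-+ [] f g = refl
sumOver-+ (x ∷ xs) f g =
  trans (cong (f x + g x +_) (sumOver-+ xs f g)) (+-interchange (f x) (g x) _ _)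

sumOver-sumTo : {A : Set} (xs : List A) (a : ℕ) (F : ℕ → A → ℕ) →
  sumOver xs (λ x → sumTo a (λ p → F p x)) ≡ sumTo a (λ p → sumOver xs (F p))
sumOver-sumTo [] a F = sym (sumTo-zero a (λ _ _ → refl))
sumOver-sumTo (x ∷ xs) a F = trans (cong (sumTo a (λ p → F p x) +_) (sumOver-sumTo xs a F))
  (sym (sumTo-+ a (λ p → F p x) (λ p → sumOver xs (F p))))

sumOver-*ʳ : {A : Set} (xs : List A) (f : A → ℕ) (c : ℕ) →
  sumOver xs (λ x → f x * c) ≡ sumOver xs f * c
sumOver-*ʳ [] f c = refl
sumOver-*ʳ (x ∷ xs) f c =
  trans (cong (f x * c +_) (sumOver-*ʳ xs f c)) (sym (*-distribʳ-+ c (f x) _))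

when : Bool → ℕ → ℕ
when b x = if b then x else 0

-- The indicator [b] ∈ {0, 1}; it is exactly the summand used in `countTrue` and `mmpAux`.
ind : Bool → ℕ
ind b = if b then 1 else 0

when-+ : ∀ b x y → when b (x + y) ≡ when b x + when b y
when-+ true x y = refl
when-+ false x y = refl

when-sumTo : ∀ b a (g : ℕ → ℕ) → when b (sumTo a g) ≡ sumTo a (λ i → when b (g i))
when-sumTo true a g = refl
when-sumTo false a g = sym (sumTo-zero a (λ _ _ → refl))

when-when : ∀ b c x → when b (when c x) ≡ when (b ∧ c) x
when-when true c x = refl
when-when false c x = refl

when-*ʳ : ∀ b x c → when b x * c ≡ when b (x * c)
when-*ʳ true x c = refl
when-*ʳ false x c = refl

T⇒≡true : ∀ {b} → T b → b ≡ true
T⇒≡true {true} _ = refl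

¬T⇒≡false : ∀ {b} → ¬ T b → b ≡ false
¬T⇒≡false {false} _ = refl
¬T⇒≡false {true} h = ⊥-elim (h tt)

<ᵇ-true : ∀ {a b} → a < b → (a <ᵇ b) ≡ true
<ᵇ-true a<b = T⇒≡true (<⇒<ᵇ a<b)

<ᵇ-false : ∀ {a b} → b ≤ a → (a <ᵇ b) ≡ false
<ᵇ-false {a} {b} b≤a = ¬T⇒≡false (λ t → ≤⇒≯ b≤a (<ᵇ⇒< a b t))

≤ᵇ-true : ∀ {p q} → p ≤ q → (p ≤ᵇ q) ≡ true
≤ᵇ-true p≤q = T⇒≡true (≤⇒≤ᵇ p≤q)

≤ᵇ-false : ∀ {p q} → q < p → (p ≤ᵇ q) ≡ false
≤ᵇ-false {p} {q} q<p = ¬T⇒≡false (λ t → <⇒≱ q<p (≤ᵇ⇒≤ p q t))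

≡ᵇ-true : ∀ a → (a ≡ᵇ a) ≡ true
≡ᵇ-true a = T⇒≡true (≡⇒≡ᵇ a a refl)

≡ᵇ-false : ∀ {a b} → a ≢ b → (a ≡ᵇ b) ≡ false
≡ᵇ-false {a} {b} a≢b = ¬T⇒≡false (λ t → a≢b (≡ᵇ⇒≡ a b t))

-- The builtin  suc p ≤ᵇ suc q  does not reduce to  p ≤ᵇ q  by itself.
≤ᵇ-suc : ∀ p q → (suc p ≤ᵇ suc q) ≡ (p ≤ᵇ q)
≤ᵇ-suc zero q = refl
≤ᵇ-suc (suc p) q = refl

ins : ℕ → ℕ → List ℕ → List ℕ
ins N zero σ = N ∷ σ
ins N (suc p) [] = N ∷ []
ins N (suc p) (x ∷ xs) = x ∷ ins N p xs

sumOver-insertions : ∀ N σ (g : List ℕ → ℕ) →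
  sumOver (insertions N σ) g ≡ sumTo (suc (length σ)) (λ p → g (ins N p σ))
sumOver-insertions N [] g = refl
sumOver-insertions N (y ∷ ys) g = cong (g (N ∷ y ∷ ys) +_)
  (trans (sumOver-map (y ∷_) (insertions N ys) g) (sumOver-insertions N ys (λ τ → g (y ∷ τ))))

ins-length : ∀ N p σ → length (ins N p σ) ≡ suc (length σ)
ins-length N zero σ = refl
ins-length N (suc p) [] = refl
ins-length N (suc p) (x ∷ xs) = cong suc (ins-length N p xs)

ins-All : {P : ℕ → Set} → ∀ N p σ → P N → All P σ → All P (ins N p σ)
ins-All N zero σ pN ps = pN ∷ ps
ins-All N (suc p) [] pN ps = pN ∷ []
ins-All N (suc p) (x ∷ xs) pN (px ∷ ps) = px ∷ ins-All N p xs pN ps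

ins-after : ∀ N (xs ys : List ℕ) → ins N (length xs) (xs ++ ys) ≡ xs ++ N ∷ ys
ins-after N [] ys = refl
ins-after N (x ∷ xs) ys = cong (x ∷_) (ins-after N xs ys)

-- Word n σ: σ has length n and entries in [1, n].  This is all the proof uses
-- about the elements of  perms n.
Word : ℕ → List ℕ → Set
Word n σ = (length σ ≡ n) × All (1 ≤_) σ × All (_≤ n) σ

ins-Word : ∀ n p σ → Word n σ → Word (suc n) (ins (suc n) p σ)
ins-Word n p σ (len , pos , bnd) =
  trans (ins-length (suc n) p σ) (cong suc len) ,
  ins-All (suc n) p σ (s≤s z≤n) pos ,
  ins-All (suc n) p σ ≤-refl (All.map m≤n⇒m≤1+n bnd)

All-insertions : {P : List ℕ → Set} → ∀ N τ → (∀ p → P (ins N p τ)) → All P (insertions N τ)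
All-insertions N [] h = h 0 ∷ []
All-insertions {P} N (y ∷ ys) h =
  h 0 ∷ map⁺ (All-insertions {λ τ → P (y ∷ τ)} N ys (λ p → h (suc p)))

perms-Word : ∀ n → All (Word n) (perms n)
perms-Word zero = (refl , [] , []) ∷ []
perms-Word (suc n) = concat⁺ (map⁺ (All.map
  (λ {σ} w → All-insertions (suc n) σ (λ p → ins-Word n p σ w)) (perms-Word n)))

someAbove : ℕ → List ℕ → Bool
someAbove a [] = false
someAbove a (b ∷ ys) = (a <ᵇ b) ∨ someAbove a ys

-- ascentAcross p σ: some entry among the first p entries of σ is smaller than
-- some entry after them.  Inserting a new maximum after position p creates a
-- 132 pattern exactly when this holds.
ascentAcross : ℕ → List ℕ → Bool
ascentAcross zero σ = false
ascentAcross (suc p) [] = false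
ascentAcross (suc p) (x ∷ xs) = someAbove x (drop p xs) ∨ ascentAcross p xs

admissible : ℕ → List ℕ → Bool
admissible p σ = not (ascentAcross p σ)

∨-interchange : ∀ a b c d → (a ∨ b) ∨ (c ∨ d) ≡ (a ∨ c) ∨ (b ∨ d)
∨-interchange true b c d = refl
∨-interchange false true true d = refl
∨-interchange false true false d = refl
∨-interchange false false c d = refl

someAbove-none : ∀ {a} ys → All (_≤ a) ys → someAbove a ys ≡ false
someAbove-none [] [] = refl
someAbove-none (y ∷ ys) (y≤a ∷ h) rewrite <ᵇ-false y≤a = someAbove-none ys h

someAbove-ins : ∀ {x N} p ys → x < N → someAbove x (ins N p ys) ≡ true
someAbove-ins zero ys x<N rewrite <ᵇ-true x<N = refl
someAbove-ins (suc p) [] x<N rewrite <ᵇ-true x<N = refl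
someAbove-ins {x} (suc p) (y ∷ ys) x<N rewrite someAbove-ins p ys x<N = ∨-zeroʳ (x <ᵇ y)

has32-none : ∀ {b} ys → All (_≤ b) ys → has32above b ys ≡ false
has32-none [] [] = refl
has32-none (y ∷ ys) (y≤b ∷ h) rewrite <ᵇ-false y≤b = has32-none ys h

any-below-max : ∀ {N} x zs → All (_< N) zs →
  any (λ z → (x <ᵇ z) ∧ (z <ᵇ N)) zs ≡ someAbove x zs
any-below-max x [] [] = refl
any-below-max x (z ∷ zs) (z<N ∷ h) rewrite <ᵇ-true z<N | ∧-identityʳ (x <ᵇ z) =
  cong ((x <ᵇ z) ∨_) (any-below-max x zs h)

any-ins : ∀ (P : ℕ → Bool) N p ys → P N ≡ false → any P (ins N p ys) ≡ any P ys
any-ins P N zero ys PN rewrite PN = refl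
any-ins P N (suc p) [] PN rewrite PN = refl
any-ins P N (suc p) (y ∷ ys) PN = cong (P y ∨_) (any-ins P N p ys PN)

has32-ins : ∀ {x N} p xs → x < N → All (_< N) xs →
  has32above x (ins N p xs) ≡ has32above x xs ∨ someAbove x (drop p xs)
has32-ins {x} zero xs x<N h rewrite <ᵇ-true x<N | any-below-max x xs h =
  ∨-comm (someAbove x xs) (has32above x xs)
has32-ins {x} (suc p) [] x<N [] rewrite <ᵇ-true x<N = refl
has32-ins {x} {N} (suc p) (y ∷ ys) x<N (y<N ∷ h)
  rewrite any-ins (λ z → (x <ᵇ z) ∧ (z <ᵇ y)) N p ys
            (trans (cong ((x <ᵇ N) ∧_) (<ᵇ-false (<⇒≤ y<N))) (∧-comm (x <ᵇ N) false))
  | has32-ins p ys x<N h = sym (∨-assoc _ (has32above x ys) (someAbove x (drop p ys)))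

contains132-ins : ∀ {N} p σ → All (_< N) σ →
  contains132 (ins N p σ) ≡ contains132 σ ∨ ascentAcross p σ
contains132-ins zero σ h rewrite has32-none σ (All.map <⇒≤ h) = sym (∨-identityʳ _)
contains132-ins (suc p) [] [] = refl
contains132-ins (suc p) (x ∷ xs) (x<N ∷ h) rewrite has32-ins p xs x<N h | contains132-ins p xs h =
  ∨-interchange (has32above x xs) (someAbove x (drop p xs)) (contains132 xs) (ascentAcross p xs)

drop-ins : ∀ {N} p q xs → p ≤ q → drop (suc q) (ins N p xs) ≡ drop q xs
drop-ins zero q xs p≤q = refl
drop-ins (suc p) (suc q) [] p≤q = refl
drop-ins (suc p) (suc q) (x ∷ xs) (s≤s p≤q) = drop-ins p q xs p≤q

drop-All : {P : ℕ → Set} → ∀ q σ → All P σ → All P (drop q σ)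
drop-All zero σ h = h
drop-All (suc q) [] h = h
drop-All (suc q) (x ∷ xs) (_ ∷ h) = drop-All q xs h

ascentAcross-ins : ∀ {N} p q σ → All (_< N) σ → p ≤ length σ →
  ascentAcross (suc q) (ins N p σ) ≡ not (p ≤ᵇ q) ∨ ascentAcross q σ
ascentAcross-ins zero q σ h p≤ rewrite someAbove-none (drop q σ) (All.map <⇒≤ (drop-All q σ h)) = refl
ascentAcross-ins (suc p) zero (x ∷ xs) (x<N ∷ h) p≤ rewrite someAbove-ins p xs x<N = refl
ascentAcross-ins {N} (suc p) (suc q) (x ∷ xs) (x<N ∷ h) (s≤s p≤)
  rewrite ascentAcross-ins p q xs h p≤ | ≤ᵇ-suc p q with p ≤? q
... | yes p≤q rewrite ≤ᵇ-true p≤q | drop-ins {N} p q xs p≤q = refl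
... | no p≰q rewrite ≤ᵇ-false (≰⇒> p≰q) = ∨-zeroʳ _

admissible-ins : ∀ {N} p q σ → All (_< N) σ → p ≤ length σ →
  admissible (suc q) (ins N p σ) ≡ (p ≤ᵇ q) ∧ admissible q σ
admissible-ins p q σ h p≤ rewrite ascentAcross-ins p q σ h p≤ with p ≤ᵇ q
... | true = refl
... | false = refl

ΣAv : ℕ → (List ℕ → ℕ) → ℕ
ΣAv n w = sumOver (perms n) (λ σ → when (avoids132 σ) (w σ))

ΣAvAdm : ℕ → (List ℕ → ℕ → ℕ) → ℕ
ΣAvAdm n h = ΣAv n (λ σ → sumTo (suc n) (λ p → when (admissible p σ) (h σ p)))

ΣAv-cong : ∀ n {f g : List ℕ → ℕ} → (∀ σ → Word n σ → f σ ≡ g σ) → ΣAv n f ≡ ΣAv n g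
ΣAv-cong n h = sumOver-cong (perms n) (perms-Word n) (λ σ w → cong (when (avoids132 σ)) (h σ w))

ΣAv-+ : ∀ n (f g : List ℕ → ℕ) → ΣAv n (λ σ → f σ + g σ) ≡ ΣAv n f + ΣAv n g
ΣAv-+ n f g = trans (sumOver-cong (perms n) (perms-Word n) (λ σ _ → when-+ (avoids132 σ) (f σ) (g σ)))
  (sumOver-+ (perms n) _ _)

ΣAv-sumTo : ∀ n a (F : ℕ → List ℕ → ℕ) →
  ΣAv n (λ σ → sumTo a (λ p → F p σ)) ≡ sumTo a (λ p → ΣAv n (F p))
ΣAv-sumTo n a F =
  trans (sumOver-cong (perms n) (perms-Word n) (λ σ _ → when-sumTo (avoids132 σ) a (λ p → F p σ)))
        (sumOver-sumTo (perms n) a (λ p σ → when (avoids132 σ) (F p σ)))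

ΣAv-*ʳ : ∀ n (g : List ℕ → ℕ) c → ΣAv n (λ σ → g σ * c) ≡ ΣAv n g * c
ΣAv-*ʳ n g c =
  trans (sumOver-cong (perms n) (perms-Word n) (λ σ _ → sym (when-*ʳ (avoids132 σ) (g σ) c)))
        (sumOver-*ʳ (perms n) (λ σ → when (avoids132 σ) (g σ)) c)

avoiders : ℕ → ℕ
avoiders n = ΣAv n (λ _ → 1)

ΣAv-const : ∀ n c → ΣAv n (λ _ → c) ≡ avoiders n * c
ΣAv-const n c = trans (ΣAv-cong n (λ _ _ → sym (*-identityˡ c))) (ΣAv-*ʳ n (λ _ → 1) c)

ΣAv-zero : ∀ n {f : List ℕ → ℕ} → (∀ σ → Word n σ → f σ ≡ 0) → ΣAv n f ≡ 0
ΣAv-zero n h = trans (ΣAv-cong n h) (trans (ΣAv-const n 0) (*-zeroʳ (avoiders n)))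

ΣAv-when : ∀ n b (g : List ℕ → ℕ) → ΣAv n (λ σ → when b (g σ)) ≡ when b (ΣAv n g)
ΣAv-when n true g = refl
ΣAv-when n false g = ΣAv-zero n (λ _ _ → refl)

ΣAvAdm-cong : ∀ n {h h′ : List ℕ → ℕ → ℕ} → (∀ σ → Word n σ → ∀ p → p ≤ n → h σ p ≡ h′ σ p) →
  ΣAvAdm n h ≡ ΣAvAdm n h′
ΣAvAdm-cong n e = ΣAv-cong n (λ σ w → sumTo-cong (suc n) (λ p p< →
  cong (when (admissible p σ)) (e σ w p (≤-pred p<))))

ΣAvAdm-+ : ∀ n (h₁ h₂ : List ℕ → ℕ → ℕ) →
  ΣAvAdm n (λ σ p → h₁ σ p + h₂ σ p) ≡ ΣAvAdm n h₁ + ΣAvAdm n h₂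
ΣAvAdm-+ n h₁ h₂ = trans (ΣAv-cong n (λ σ _ →
    trans (sumTo-cong (suc n) (λ p _ → when-+ (admissible p σ) (h₁ σ p) (h₂ σ p)))
          (sumTo-+ (suc n) (λ p → when (admissible p σ) (h₁ σ p)) (λ p → when (admissible p σ) (h₂ σ p)))))
  (ΣAv-+ n _ _)

avoids-ins : ∀ c d x → when (if (c ∨ d) then false else true) x ≡
  when (if c then false else true) (when (not d) x)
avoids-ins true d x = refl
avoids-ins false true x = refl
avoids-ins false false x = refl

ΣAv-insert : ∀ n (w : List ℕ → ℕ) → ΣAv (suc n) w ≡ ΣAvAdm n (λ σ p → w (ins (suc n) p σ))
ΣAv-insert n w = trans (sumOver-concatMap (insertions (suc n)) (perms n) _)
  (sumOver-cong (perms n) (perms-Word n) per-σ)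
  where
  per-σ : ∀ σ → Word n σ →
    sumOver (insertions (suc n) σ) (λ τ → when (avoids132 τ) (w τ)) ≡
    when (avoids132 σ) (sumTo (suc n) (λ p → when (admissible p σ) (w (ins (suc n) p σ))))
  per-σ σ (len , _ , bnd)
    rewrite sumOver-insertions (suc n) σ (λ τ → when (avoids132 τ) (w τ)) | len
    | when-sumTo (avoids132 σ) (suc n) (λ p → when (admissible p σ) (w (ins (suc n) p σ))) =
    sumTo-cong (suc n) (λ p _ →
      trans (cong (λ c → when (if c then false else true) (w (ins (suc n) p σ)))
                  (contains132-ins p σ (All.map s≤s bnd)))
            (avoids-ins (contains132 σ) (ascentAcross p σ) _))

shift : ℕ → List ℕ → List ℕ
shift m = map (m +_)

<ᵇ-shift : ∀ m a b → (m + a <ᵇ m + b) ≡ (a <ᵇ b)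
<ᵇ-shift zero a b = refl
<ᵇ-shift (suc m) a b = <ᵇ-shift m a b

someAbove-shift : ∀ m a xs → someAbove (m + a) (shift m xs) ≡ someAbove a xs
someAbove-shift m a [] = refl
someAbove-shift m a (x ∷ xs) rewrite <ᵇ-shift m a x | someAbove-shift m a xs = refl

someAbove-++ : ∀ a xs ys → someAbove a (xs ++ ys) ≡ someAbove a xs ∨ someAbove a ys
someAbove-++ a [] ys = refl
someAbove-++ a (x ∷ xs) ys rewrite someAbove-++ a xs ys =
  sym (∨-assoc (a <ᵇ x) (someAbove a xs) (someAbove a ys))

drop-++ : ∀ p (xs ys : List ℕ) → p ≤ length xs → drop p (xs ++ ys) ≡ drop p xs ++ ys
drop-++ zero xs ys p≤ = refl
drop-++ (suc p) (x ∷ xs) ys (s≤s p≤) = drop-++ p xs ys p≤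

ascentAcross-concat : ∀ m p α β → p ≤ length α → All (1 ≤_) α → All (_≤ m) β →
  ascentAcross p (shift m α ++ β) ≡ ascentAcross p α
ascentAcross-concat m zero α β p≤ pos bnd = refl
ascentAcross-concat m (suc p) (x ∷ α) β (s≤s p≤) (_ ∷ pos) bnd
  rewrite ascentAcross-concat m p α β p≤ pos bnd
  | drop-++ p (shift m α) β (subst (p ≤_) (sym (length-map (m +_) α)) p≤)
  | someAbove-++ (m + x) (drop p (shift m α)) β
  | someAbove-none {m + x} β (All.map (λ {y} y≤m → ≤-trans y≤m (m≤m+n m x)) bnd)
  | drop-map {f = m +_} p α
  | someAbove-shift m x (drop p α)
  | ∨-identityʳ (someAbove x (drop p α)) = refl

ins-concat : ∀ m K p α β → p ≤ length α → ins (m + K) p (shift m α ++ β) ≡ shift m (ins K p α) ++ β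
ins-concat m K zero α β p≤ = refl
ins-concat m K (suc p) (x ∷ α) β (s≤s p≤) = cong ((m + x) ∷_) (ins-concat m K p α β p≤)

guarded-swap : ∀ m (a : ℕ → Bool) (H : ℕ → ℕ → ℕ) →
  sumTo m (λ p → when (a p) (sumTo m (λ q → when ((p ≤ᵇ q) ∧ a q) (H p q)))) ≡
  sumTo m (λ q → when (a q) (sumTo m (λ p → when ((p ≤ᵇ q) ∧ a p) (H p q))))
guarded-swap m a H =
  begin
    sumTo m (λ p → when (a p) (sumTo m (λ q → when ((p ≤ᵇ q) ∧ a q) (H p q))))
  ≡⟨ sumTo-cong m (λ p _ → inner-guard p) ⟩
    sumTo m (λ p → sumTo m (λ q → when (a p ∧ ((p ≤ᵇ q) ∧ a q)) (H p q)))
  ≡⟨ sumTo-swap m m (λ p q → when (a p ∧ ((p ≤ᵇ q) ∧ a q)) (H p q)) ⟩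
    sumTo m (λ q → sumTo m (λ p → when (a p ∧ ((p ≤ᵇ q) ∧ a q)) (H p q)))
  ≡⟨ sumTo-cong m (λ q _ → sym (outer-guard q)) ⟩
    sumTo m (λ q → when (a q) (sumTo m (λ p → when ((p ≤ᵇ q) ∧ a p) (H p q))))
  ∎
  where
  open ≡-Reasoning
  ∧-rotate : ∀ x l y → x ∧ (l ∧ y) ≡ y ∧ (l ∧ x)
  ∧-rotate true l true = refl
  ∧-rotate true l false = ∧-comm l false
  ∧-rotate false l true = sym (∧-comm l false)
  ∧-rotate false l false = refl
  inner-guard : ∀ p → when (a p) (sumTo m (λ q → when ((p ≤ᵇ q) ∧ a q) (H p q))) ≡
                       sumTo m (λ q → when (a p ∧ ((p ≤ᵇ q) ∧ a q)) (H p q))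
  inner-guard p = trans (when-sumTo (a p) m _) (sumTo-cong m (λ q _ → when-when (a p) _ (H p q)))
  outer-guard : ∀ q → when (a q) (sumTo m (λ p → when ((p ≤ᵇ q) ∧ a p) (H p q))) ≡
                       sumTo m (λ p → when (a p ∧ ((p ≤ᵇ q) ∧ a q)) (H p q))
  outer-guard q = trans (when-sumTo (a q) m _) (sumTo-cong m (λ p _ →
    trans (when-when (a q) _ (H p q)) (cong (λ c → when c (H p q)) (∧-rotate (a q) (p ≤ᵇ q) (a p)))))

-- earlier n h σ q sums, over the admissible positions p ≤ q of σ, the weight h
-- of the word ins (n+1) p σ at position q+1; by `admissible-ins` these are all
-- contributions of the admissible positions q+1 of the words ins (n+1) p σ.
earlier : ℕ → (List ℕ → ℕ → ℕ) → List ℕ → ℕ → ℕ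
earlier n h σ q = sumTo (suc n) (λ p → when ((p ≤ᵇ q) ∧ admissible p σ) (h (ins (suc n) p σ) (suc q)))

ΣAvAdm-peel : ∀ n (h : List ℕ → ℕ → ℕ) →
  ΣAvAdm (suc n) h ≡ ΣAv (suc n) (λ τ → h τ 0) + ΣAvAdm n (earlier n h)
ΣAvAdm-peel n h =
  begin
    ΣAvAdm (suc n) h
  ≡⟨ ΣAv-insert n G ⟩
    ΣAvAdm n (λ σ p → G (ins N p σ))
  ≡⟨ ΣAvAdm-cong n (λ σ w p p≤ → cong (h (ins N p σ) 0 +_) (later-positions σ w p p≤)) ⟩
    ΣAvAdm n (λ σ p → h (ins N p σ) 0 + B σ p)
  ≡⟨ ΣAvAdm-+ n (λ σ p → h (ins N p σ) 0) B ⟩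
    ΣAvAdm n (λ σ p → h (ins N p σ) 0) + ΣAvAdm n B
  ≡⟨ cong₂ _+_ (sym (ΣAv-insert n (λ τ → h τ 0)))
               (ΣAv-cong n (λ σ _ → guarded-swap (suc n) (λ p → admissible p σ)
                                                 (λ p q → h (ins N p σ) (suc q)))) ⟩
    ΣAv (suc n) (λ τ → h τ 0) + ΣAvAdm n (earlier n h)
  ∎
  where
  open ≡-Reasoning
  N = suc n
  G : List ℕ → ℕ
  G τ = sumTo (suc (suc n)) (λ q → when (admissible q τ) (h τ q))
  B : List ℕ → ℕ → ℕ
  B σ p = sumTo (suc n) (λ q → when ((p ≤ᵇ q) ∧ admissible q σ) (h (ins N p σ) (suc q)))
  later-positions : ∀ σ → Word n σ → ∀ p → p ≤ n →
    sumTo (suc n) (λ q → when (admissible (suc q) (ins N p σ)) (h (ins N p σ) (suc q))) ≡ B σ p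
  later-positions σ (len , _ , bnd) p p≤ = sumTo-cong (suc n) (λ q _ →
    cong (λ c → when c (h (ins N p σ) (suc q)))
         (admissible-ins p q σ (All.map s≤s bnd) (subst (p ≤_) (sym len) p≤)))

earlier-concat : ∀ n i (h : List ℕ → ℕ → ℕ) α β → i ≤ n → Word i α → Word (n ∸ i) β →
  earlier n h (shift (n ∸ i) α ++ β) i ≡
  sumTo (suc i) (λ p → when (admissible p α) (h (shift (n ∸ i) (ins (suc i) p α) ++ β) (suc i)))
earlier-concat n i h α β i≤n (lenα , posα , _) (_ , _ , bndβ) =
  trans (cong (λ t → sumTo t F) (trans n+1≡m+i+1 (+-comm m (suc i))))
  (trans (sumTo-split (suc i) m F)
  (trans (cong₂ _+_ (sumTo-cong (suc i) inside) (sumTo-zero m outside))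
  (+-identityʳ _)))
  where
  m = n ∸ i
  n+1≡m+i+1 : suc n ≡ m + suc i
  n+1≡m+i+1 = sym (trans (+-suc m i) (cong suc (m∸n+n≡m i≤n)))
  F : ℕ → ℕ
  F p = when ((p ≤ᵇ i) ∧ admissible p (shift m α ++ β)) (h (ins (suc n) p (shift m α ++ β)) (suc i))
  outside : ∀ j → j < m → F (suc i + j) ≡ 0
  outside j _ rewrite ≤ᵇ-false {suc i + j} {i} (s≤s (m≤m+n i j)) = refl
  inside : ∀ p → p < suc i → F p ≡ when (admissible p α) (h (shift m (ins (suc i) p α) ++ β) (suc i))
  inside p p< rewrite ≤ᵇ-true (≤-pred p<)
    | ascentAcross-concat m p α β (subst (p ≤_) (sym lenα) (≤-pred p<)) posα bndβ
    | n+1≡m+i+1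
    | ins-concat m (suc i) p α β (subst (p ≤_) (sym lenα) (≤-pred p<)) = refl

-- Summing `earlier` over (α, β) with |α| = i reassembles, via ΣAv-insert for α,
-- the sum over α ∈ S_{i+1}(132) with position i+1.
concat-step : ∀ n i (h : List ℕ → ℕ → ℕ) → i ≤ n →
  ΣAv i (λ α → ΣAv (n ∸ i) (λ β → earlier n h (shift (n ∸ i) α ++ β) i)) ≡
  ΣAv (suc i) (λ α → ΣAv (n ∸ i) (λ β → h (shift (n ∸ i) α ++ β) (suc i)))
concat-step n i h i≤n =
  begin
    ΣAv i (λ α → ΣAv m (λ β → earlier n h (shift m α ++ β) i))
  ≡⟨ ΣAv-cong i (λ α wα → ΣAv-cong m (λ β wβ → earlier-concat n i h α β i≤n wα wβ)) ⟩
    ΣAv i (λ α → ΣAv m (λ β → sumTo (suc i) (λ p → when (admissible p α) (K α p β))))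
  ≡⟨ ΣAv-cong i (λ α _ → trans (ΣAv-sumTo m (suc i) (λ p β → when (admissible p α) (K α p β)))
                               (sumTo-cong (suc i) (λ p _ → ΣAv-when m (admissible p α) (K α p)))) ⟩
    ΣAvAdm i (λ α p → ΣAv m (K α p))
  ≡⟨ sym (ΣAv-insert i (λ α → ΣAv m (λ β → h (shift m α ++ β) (suc i)))) ⟩
    ΣAv (suc i) (λ α → ΣAv m (λ β → h (shift m α ++ β) (suc i)))
  ∎
  where
  open ≡-Reasoning
  m = n ∸ i
  K : List ℕ → ℕ → List ℕ → ℕ
  K α p β = h (shift m (ins (suc i) p α) ++ β) (suc i)

-- The admissible pairs (σ, p) with σ ∈ S_n(132) are exactly σ = (α + (n−i)) ++ β
-- with p = i, α ∈ S_i(132), β ∈ S_{n−i}(132).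
ΣAvAdm-concat : ∀ n (h : List ℕ → ℕ → ℕ) →
  ΣAvAdm n h ≡ sumTo (suc n) (λ i → ΣAv i (λ α → ΣAv (n ∸ i) (λ β → h (shift (n ∸ i) α ++ β) i)))
ΣAvAdm-concat zero h = sym (+-identityʳ _)
ΣAvAdm-concat (suc n) h =
  begin
    ΣAvAdm (suc n) h
  ≡⟨ ΣAvAdm-peel n h ⟩
    ΣAv (suc n) (λ τ → h τ 0) + ΣAvAdm n (earlier n h)
  ≡⟨ cong₂ _+_ (sym (+-identityʳ _)) (ΣAvAdm-concat n (earlier n h)) ⟩
    (ΣAv (suc n) (λ τ → h τ 0) + 0) +
      sumTo (suc n) (λ i → ΣAv i (λ α → ΣAv (n ∸ i) (λ β → earlier n h (shift (n ∸ i) α ++ β) i)))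
  ≡⟨ cong (ΣAv (suc n) (λ τ → h τ 0) + 0 +_) (sumTo-cong (suc n) (λ i i< → concat-step n i h (≤-pred i<))) ⟩
    (ΣAv (suc n) (λ τ → h τ 0) + 0) +
      sumTo (suc n) (λ i → ΣAv (suc i) (λ α → ΣAv (n ∸ i) (λ β → h (shift (n ∸ i) α ++ β) (suc i))))
  ∎
  where open ≡-Reasoning

ΣAv-decomposition : ∀ n (w : List ℕ → ℕ) → ΣAv (suc n) w ≡
  sumTo (suc n) (λ i → ΣAv i (λ α → ΣAv (n ∸ i) (λ β → w (shift (n ∸ i) α ++ suc n ∷ β))))
ΣAv-decomposition n w =
  trans (ΣAv-insert n w) (trans (ΣAvAdm-concat n (λ σ p → w (ins (suc n) p σ)))
  (sumTo-cong (suc n) (λ i _ → ΣAv-cong i (λ α (lenα , _) → ΣAv-cong (n ∸ i) (λ β _ →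
    cong w (subst (λ t → ins (suc n) t (shift (n ∸ i) α ++ β) ≡ shift (n ∸ i) α ++ suc n ∷ β)
                  (trans (length-map ((n ∸ i) +_) α) lenα)
                  (ins-after (suc n) (shift (n ∸ i) α) β)))))))

mmpAux-++ : ∀ k pre xs ys → mmpAux k pre (xs ++ ys) ≡ mmpAux k pre xs + mmpAux k (xs ʳ++ pre) ys
mmpAux-++ k pre [] ys = refl
mmpAux-++ k pre (x ∷ xs) ys = trans (cong (ind (k ≤ᵇ countGreater x pre) +_) (mmpAux-++ k (x ∷ pre) xs ys))
  (sym (+-assoc (ind (k ≤ᵇ countGreater x pre)) (mmpAux k (x ∷ pre) xs) _))

countGreater-shift : ∀ m x pre → countGreater (m + x) (shift m pre) ≡ countGreater x pre
countGreater-shift m x [] = refl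
countGreater-shift m x (y ∷ ys) rewrite <ᵇ-shift m x y | countGreater-shift m x ys = refl

mmpAux-shift : ∀ k m pre xs → mmpAux k (shift m pre) (shift m xs) ≡ mmpAux k pre xs
mmpAux-shift k m pre [] = refl
mmpAux-shift k m pre (x ∷ xs) rewrite countGreater-shift m x pre =
  cong (ind (k ≤ᵇ countGreater x pre) +_) (mmpAux-shift k m (x ∷ pre) xs)

countGreater-++ : ∀ x xs ys → countGreater x (xs ++ ys) ≡ countGreater x xs + countGreater x ys
countGreater-++ x [] ys = refl
countGreater-++ x (y ∷ xs) ys rewrite countGreater-++ x xs ys =
  sym (+-assoc (ind (x <ᵇ y)) (countGreater x xs) (countGreater x ys))

countGreater-all : ∀ x ys → All (x <_) ys → countGreater x ys ≡ length ys
countGreater-all x [] [] = refl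
countGreater-all x (y ∷ ys) (x<y ∷ h) rewrite <ᵇ-true x<y = cong suc (countGreater-all x ys h)

countGreater-none : ∀ x ys → All (_≤ x) ys → countGreater x ys ≡ 0
countGreater-none x [] [] = refl
countGreater-none x (y ∷ ys) (y≤x ∷ h) rewrite <ᵇ-false y≤x = countGreater-none x ys h

countGreater-≤ : ∀ x pre → countGreater x pre ≤ length pre
countGreater-≤ x [] = z≤n
countGreater-≤ x (y ∷ ys) with x <ᵇ y
... | true = s≤s (countGreater-≤ x ys)
... | false = m≤n⇒m≤1+n (countGreater-≤ x ys)

<ᵇ-suc : ∀ k n → (k <ᵇ suc n) ≡ (k ≤ᵇ n)
<ᵇ-suc zero n = refl
<ᵇ-suc (suc k) n = refl

≤ᵇ-∸ : ∀ k L c → (k ≤ᵇ c + L) ≡ (k ∸ L ≤ᵇ c)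
≤ᵇ-∸ k zero c rewrite +-identityʳ c = refl
≤ᵇ-∸ zero (suc L) c = refl
≤ᵇ-∸ (suc k) (suc L) c rewrite +-suc c L = trans (<ᵇ-suc k (c + L)) (≤ᵇ-∸ k L c)

-- Earlier entries exceeding every later one each count once for every later
-- position, so they lower the threshold k by their number.
mmpAux-above : ∀ k m pre bigs xs → All (_≤ m) xs → All (m <_) bigs →
  mmpAux k (pre ++ bigs) xs ≡ mmpAux (k ∸ length bigs) pre xs
mmpAux-above k m pre bigs [] _ _ = refl
mmpAux-above k m pre bigs (x ∷ xs) (x≤m ∷ h) hb
  rewrite countGreater-++ x pre bigs
  | countGreater-all x bigs (All.map (λ {y} m<y → <-≤-trans (s≤s x≤m) m<y) hb)
  | ≤ᵇ-∸ k (length bigs) (countGreater x pre) =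
  cong (ind (k ∸ length bigs ≤ᵇ countGreater x pre) +_) (mmpAux-above k m (x ∷ pre) bigs xs h hb)

All-ʳ++ : {P : ℕ → Set} → ∀ xs pre → All P xs → All P pre → All P (xs ʳ++ pre)
All-ʳ++ [] pre _ hp = hp
All-ʳ++ (x ∷ xs) pre (px ∷ h) hp = All-ʳ++ xs (x ∷ pre) h (px ∷ hp)

length-ʳ++ : ∀ (xs pre : List ℕ) → length (xs ʳ++ pre) ≡ length xs + length pre
length-ʳ++ [] pre = refl
length-ʳ++ (x ∷ xs) pre = trans (length-ʳ++ xs (x ∷ pre)) (+-suc _ _)

-- For τ = (α + (n−i)) (n+1) β: the entries of α + (n−i) see only each other, the
-- maximum n+1 sees nothing above it, and every entry of β sees all i+1 entries
-- before it as larger.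
mmp-concat : ∀ k n i α β → i ≤ n → Word i α → Word (n ∸ i) β →
  mmp k (shift (n ∸ i) α ++ suc n ∷ β) ≡ mmp k α + (ind (k ≤ᵇ 0) + mmp (k ∸ suc i) β)
mmp-concat k n i α β i≤n (lenα , posα , bndα) (_ , _ , bndβ) =
  begin
    mmpAux k [] (sα ++ suc n ∷ β)
  ≡⟨ mmpAux-++ k [] sα (suc n ∷ β) ⟩
    mmpAux k [] sα + mmpAux k (sα ʳ++ []) (suc n ∷ β)
  ≡⟨ cong₂ _+_ (mmpAux-shift k m [] α)
       (cong (λ c → ind (k ≤ᵇ c) + mmpAux k (suc n ∷ sα ʳ++ []) β) max-sees-none) ⟩
    mmp k α + (ind (k ≤ᵇ 0) + mmpAux k ([] ++ (suc n ∷ sα ʳ++ [])) β)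
  ≡⟨ cong (λ t → mmp k α + (ind (k ≤ᵇ 0) + t)) (mmpAux-above k m [] (suc n ∷ sα ʳ++ []) β bndβ larger) ⟩
    mmp k α + (ind (k ≤ᵇ 0) + mmpAux (k ∸ length (suc n ∷ sα ʳ++ [])) [] β)
  ≡⟨ cong (λ t → mmp k α + (ind (k ≤ᵇ 0) + mmpAux (k ∸ t) [] β)) count ⟩
    mmp k α + (ind (k ≤ᵇ 0) + mmp (k ∸ suc i) β)
  ∎
  where
  open ≡-Reasoning
  m = n ∸ i
  sα = shift m α
  max-sees-none : countGreater (suc n) (sα ʳ++ []) ≡ 0
  max-sees-none = countGreater-none (suc n) _ (All-ʳ++ sα []
    (map⁺ (All.map (λ {x} x≤i → m≤n⇒m≤1+n (subst (m + x ≤_) (m∸n+n≡m i≤n) (+-monoʳ-≤ m x≤i))) bndα)) [])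
  larger : All (m <_) (suc n ∷ sα ʳ++ [])
  larger = s≤s (m∸n≤m n i) ∷ All-ʳ++ sα [] (map⁺ (All.map (λ {x} 1≤x → m<m+n m 1≤x) posα)) []
  count : length (suc n ∷ sα ʳ++ []) ≡ suc i
  count = cong suc (trans (length-ʳ++ sα []) (trans (+-identityʳ _) (trans (length-map (m +_) α) lenα)))

ind≤1 : ∀ b → ind b ≤ 1
ind≤1 true = ≤-refl
ind≤1 false = z≤n

mmpAux-bound : ∀ k pre xs → mmpAux k pre xs ≤ length xs ∸ (k ∸ length pre)
mmpAux-bound k pre [] = z≤n
mmpAux-bound k pre (x ∷ xs) with k ≤? length pre
... | yes k≤ rewrite m≤n⇒m∸n≡0 k≤ =
  +-mono-≤ (ind≤1 (k ≤ᵇ countGreater x pre))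
           (≤-trans (mmpAux-bound k (x ∷ pre) xs) (m∸n≤m (length xs) (k ∸ suc (length pre))))
mmpAux-bound zero pre (x ∷ xs) | no k≰ = ⊥-elim (k≰ z≤n)
mmpAux-bound (suc k) pre (x ∷ xs) | no k≰
  rewrite ≤ᵇ-false {suc k} {countGreater x pre} (<-≤-trans (s≤s (countGreater-≤ x pre)) (≰⇒> k≰))
  | +-∸-assoc 1 (≤-pred (≰⇒> k≰)) = mmpAux-bound (suc k) (x ∷ pre) xs

-- The first k positions never count:  mmp k σ ≤ |σ| − k.
mmp-bound : ∀ k σ → mmp k σ ≤ length σ ∸ k
mmp-bound k σ = mmpAux-bound k [] σ

mmpAux-0 : ∀ pre σ → mmpAux 0 pre σ ≡ length σ
mmpAux-0 pre [] = refl
mmpAux-0 pre (x ∷ xs) = cong suc (mmpAux-0 (x ∷ pre) xs)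

mmp-Word-bound : ∀ {n} k σ → Word n σ → mmp k σ ≤ n ∸ k
mmp-Word-bound k σ (len , _) = subst (λ l → mmp k σ ≤ l ∸ k) len (mmp-bound k σ)

mmp-0 : ∀ {n} σ → Word n σ → mmp 0 σ ≡ n
mmp-0 σ (len , _) = trans (mmpAux-0 [] σ) len

mmp-short : ∀ {i} k α → Word i α → i ≤ k → mmp (suc k) α ≡ 0
mmp-short {i} k α w i≤k =
  n≤0⇒n≡0 (subst (mmp (suc k) α ≤_) (m≤n⇒m∸n≡0 (m≤n⇒m≤1+n i≤k)) (mmp-Word-bound (suc k) α w))

qcoeff : ℕ → ℕ → ℕ → ℕ
qcoeff n k r = ΣAv n (λ σ → ind (mmp k σ ≡ᵇ r))

Qcoeff≡qcoeff : ∀ n k r → Qcoeff n k r ≡ qcoeff n k r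
Qcoeff≡qcoeff n k r = go (perms n)
  where
  go : ∀ L → countTrue (map (λ σ → avoids132 σ ∧ (mmp k σ ≡ᵇ r)) L) ≡
             sumOver L (λ σ → when (avoids132 σ) (ind (mmp k σ ≡ᵇ r)))
  go [] = refl
  go (σ ∷ L) with avoids132 σ
  ... | true = cong (ind (mmp k σ ≡ᵇ r) +_) (go L)
  ... | false = go L

avoiders-segner : ∀ n → avoiders (suc n) ≡ (avoiders ⋆ avoiders) n
avoiders-segner n = trans (ΣAv-decomposition n (λ _ → 1))
  (sumTo-cong (suc n) (λ i _ → ΣAv-const i (avoiders (n ∸ i))))

avoiders≡catalan : ∀ n → avoiders n ≡ catalan n
avoiders≡catalan = segner-unique {avoiders} {catalan} refl avoiders-segner catalan-segner

avoiders≡Cat : ∀ n → avoiders n ≡ Cat n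
avoiders≡Cat n = trans (avoiders≡catalan n) (sym (Cat≡catalan n))

avoiders-pos : ∀ n → 1 ≤ avoiders n
avoiders-pos n = subst (1 ≤_) (sym (avoiders≡catalan n)) (ballot-pos 0 n)

qcoeff-vanish : ∀ n k r → n ∸ k < r → qcoeff n k r ≡ 0
qcoeff-vanish n k r n∸k<r = ΣAv-zero n (λ σ w → cong ind (≡ᵇ-false (λ e →
  <-irrefl e (≤-<-trans (mmp-Word-bound k σ w) n∸k<r))))

-- Splitting τ ∈ S_{k+1+m}(132) at its maximum (ΣAv-decomposition): if the block
-- α before the maximum has i ≤ k entries, only β contributes, with threshold k−i;
-- if it has k+1+j entries, every entry of β counts.
qcoeff-decomposition : ∀ k m r → qcoeff (suc k + m) (suc k) r ≡
  sumTo (suc k) (λ i → avoiders i * qcoeff (k ∸ i + m) (k ∸ i) r) +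
  sumTo m (λ j → ΣAv (suc k + j) (λ α → ind (mmp (suc k) α + (m ∸ suc j) ≡ᵇ r)) * avoiders (m ∸ suc j))
qcoeff-decomposition k m r =
  trans (ΣAv-decomposition n (λ σ → ind (mmp (suc k) σ ≡ᵇ r)))
  (trans (sumTo-split (suc k) m E)
         (cong₂ _+_ (sumTo-cong (suc k) (λ i i< → short-block i (≤-pred i<)))
                    (sumTo-cong m long-block)))
  where
  n = k + m
  E : ℕ → ℕ
  E i = ΣAv i (λ α → ΣAv (n ∸ i) (λ β → ind (mmp (suc k) (shift (n ∸ i) α ++ suc n ∷ β) ≡ᵇ r)))
  short-block : ∀ i → i ≤ k → E i ≡ avoiders i * qcoeff (k ∸ i + m) (k ∸ i) r
  short-block i i≤k =
    trans (ΣAv-cong i (λ α wα → ΣAv-cong (n ∸ i) (λ β wβ → cong (λ z → ind (z ≡ᵇ r))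
            (trans (mmp-concat (suc k) n i α β (≤-trans i≤k (m≤m+n k m)) wα wβ)
                   (cong (_+ mmp (k ∸ i) β) (mmp-short k α wα i≤k))))))
    (trans (cong (λ l → ΣAv i (λ _ → qcoeff l (k ∸ i) r)) (+-∸-comm m i≤k))
           (ΣAv-const i _))
  long-block : ∀ j → j < m →
    E (suc k + j) ≡ ΣAv (suc k + j) (λ α → ind (mmp (suc k) α + (m ∸ suc j) ≡ᵇ r)) * avoiders (m ∸ suc j)
  long-block j j<m =
    trans (ΣAv-cong i (λ α wα → ΣAv-cong (n ∸ i) (λ β wβ → cong (λ z → ind (z ≡ᵇ r))
            (trans (mmp-concat (suc k) n i α β i≤n wα wβ)
                   (cong (mmp (suc k) α +_) (β-all-count β wβ))))))
    (trans (ΣAv-cong i (λ α _ → trans (ΣAv-const (n ∸ i) (hit α))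
                                (trans (cong (λ l → avoiders l * hit α) rest) (*-comm _ (hit α)))))
           (ΣAv-*ʳ i hit (avoiders (m ∸ suc j))))
    where
    i = suc k + j
    hit : List ℕ → ℕ
    hit α = ind (mmp (suc k) α + (m ∸ suc j) ≡ᵇ r)
    i≤n : i ≤ n
    i≤n = subst (_≤ n) (+-suc k j) (+-monoʳ-≤ k j<m)
    rest : n ∸ i ≡ m ∸ suc j
    rest = trans (cong (n ∸_) (sym (+-suc k j))) ([m+n]∸[m+o]≡n∸o k m (suc j))
    β-all-count : ∀ β → Word (n ∸ i) β → mmp (k ∸ i) β ≡ m ∸ suc j
    β-all-count β wβ = trans (cong (λ z → mmp z β) (m≤n⇒m∸n≡0 (≤-trans (m≤m+n k j) (n≤1+n _))))
                             (trans (mmp-0 β wβ) rest)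

mmp-long-bound : ∀ k j α → Word (suc k + j) α → mmp (suc k) α ≤ j
mmp-long-bound k j α w = subst (mmp (suc k) α ≤_) (m+n∸m≡n (suc k) j) (mmp-Word-bound (suc k) α w)

+-∸-below : ∀ x j t → x ≤ j → j < t → x + (t ∸ suc j) < t
+-∸-below x j t x≤j j<t = ≤-<-trans (+-monoˡ-≤ (t ∸ suc j) x≤j)
  (subst (j + (t ∸ suc j) <_) (m+[n∸m]≡n j<t) (n<1+n _))

+-∸-≡ᵇ : ∀ x j t → x ≤ j → j ≤ t → (x + (t ∸ j) ≡ᵇ t) ≡ (x ≡ᵇ j)
+-∸-≡ᵇ x j t x≤j j≤t with x ≟ j
... | yes refl rewrite m+[n∸m]≡n j≤t = trans (≡ᵇ-true t) (sym (≡ᵇ-true x))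
... | no x≢j = trans (≡ᵇ-false (λ e → <-irrefl e below)) (sym (≡ᵇ-false x≢j))
  where
  below : x + (t ∸ j) < t
  below = <-≤-trans (+-monoˡ-< (t ∸ j) (≤∧≢⇒< x≤j x≢j)) (≤-reflexive (m+[n∸m]≡n j≤t))

-- Part (1), top coefficient:  Q_{k+t}(x)|_{x^t} = C_k C_t.  Only blocks α with
-- at most k entries contribute, recursively with the smaller threshold.
qcoeff-top : ∀ k t → qcoeff (k + t) k t ≡ avoiders k * avoiders t
qcoeff-top = <-rec (λ k → ∀ t → qcoeff (k + t) k t ≡ avoiders k * avoiders t) step
  where
  step : ∀ k → (∀ {k′} → k′ < k → ∀ t → qcoeff (k′ + t) k′ t ≡ avoiders k′ * avoiders t) →
    ∀ t → qcoeff (k + t) k t ≡ avoiders k * avoiders t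
  step zero _ t = trans (ΣAv-cong t (λ σ w → cong ind (trans (cong (_≡ᵇ t) (mmp-0 σ w)) (≡ᵇ-true t))))
                        (sym (+-identityʳ _))
  step (suc k) ih t =
    begin
      qcoeff (suc k + t) (suc k) t
    ≡⟨ qcoeff-decomposition k t t ⟩
      sumTo (suc k) (λ i → avoiders i * qcoeff (k ∸ i + t) (k ∸ i) t) + sumTo t long
    ≡⟨ cong₂ _+_ (sumTo-cong (suc k) (λ i _ → cong (avoiders i *_) (ih (s≤s (m∸n≤m k i)) t)))
                 (sumTo-zero t no-long-block) ⟩
      sumTo (suc k) (λ i → avoiders i * (avoiders (k ∸ i) * avoiders t)) + 0
    ≡⟨ trans (+-identityʳ _) (sumTo-factorʳ (suc k) avoiders (λ i → avoiders (k ∸ i)) (avoiders t)) ⟩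
      (avoiders ⋆ avoiders) k * avoiders t
    ≡⟨ cong (_* avoiders t) (sym (avoiders-segner k)) ⟩
      avoiders (suc k) * avoiders t
    ∎
    where
    open ≡-Reasoning
    long : ℕ → ℕ
    long j = ΣAv (suc k + j) (λ α → ind (mmp (suc k) α + (t ∸ suc j) ≡ᵇ t)) * avoiders (t ∸ suc j)
    no-long-block : ∀ j → j < t → long j ≡ 0
    no-long-block j j<t = cong (_* avoiders (t ∸ suc j)) (ΣAv-zero (suc k + j) (λ α w →
      cong ind (≡ᵇ-false (λ e → <-irrefl e (+-∸-below _ j t (mmp-long-bound k j α w) j<t)))))

qcoeff-subtop : (a : ℕ → ℕ) →
  (∀ k → a (suc k) ≡ avoiders (suc k) + sumTo k (λ i → avoiders i * a (k ∸ i))) →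
  ∀ k t → qcoeff (suc k + suc t) (suc k) t ≡ a (suc k) * avoiders (suc t)
qcoeff-subtop a a-rec = <-rec P step
  where
  P : ℕ → Set
  P k = ∀ t → qcoeff (suc k + suc t) (suc k) t ≡ a (suc k) * avoiders (suc t)
  step : ∀ k → (∀ {k′} → k′ < k → P k′) → P k
  step k ih t =
    begin
      qcoeff (suc k + suc t) (suc k) t
    ≡⟨ qcoeff-decomposition k (suc t) t ⟩
      sumTo (suc k) short + sumTo (suc t) long
    ≡⟨ cong₂ _+_ short-sum long-sum ⟩
      sumTo k (λ i → avoiders i * a (k ∸ i)) * avoiders (suc t) + avoiders (suc k) * avoiders (suc t)
    ≡⟨ sym (*-distribʳ-+ (avoiders (suc t)) (sumTo k (λ i → avoiders i * a (k ∸ i))) (avoiders (suc k))) ⟩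
      (sumTo k (λ i → avoiders i * a (k ∸ i)) + avoiders (suc k)) * avoiders (suc t)
    ≡⟨ cong (_* avoiders (suc t)) (trans (+-comm _ (avoiders (suc k))) (sym (a-rec k))) ⟩
      a (suc k) * avoiders (suc t)
    ∎
    where
    open ≡-Reasoning
    short : ℕ → ℕ
    short i = avoiders i * qcoeff (k ∸ i + suc t) (k ∸ i) t
    long : ℕ → ℕ
    long j = ΣAv (suc k + j) (λ α → ind (mmp (suc k) α + (t ∸ j) ≡ᵇ t)) * avoiders (t ∸ j)
    -- a block of i < k entries leaves threshold k − i ≥ 1 for β: induction hypothesis
    short-term : ∀ i → i < k → qcoeff (k ∸ i + suc t) (k ∸ i) t ≡ a (k ∸ i) * avoiders (suc t)
    short-term i i<k = subst (λ l → qcoeff (l + suc t) l t ≡ a l * avoiders (suc t))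
      (sym (+-∸-assoc 1 i<k)) (ih (∸-monoʳ-< {k} {suc i} {0} z<s i<k) t)
    -- a block of exactly k entries leaves threshold 0: all t+1 entries of β count
    last-term : qcoeff (k ∸ k + suc t) (k ∸ k) t ≡ 0
    last-term rewrite n∸n≡0 k = ΣAv-zero (suc t) (λ β w →
      cong ind (≡ᵇ-false (λ e → 1+n≢n (trans (sym (mmp-0 β w)) e))))
    short-sum : sumTo (suc k) short ≡ sumTo k (λ i → avoiders i * a (k ∸ i)) * avoiders (suc t)
    short-sum =
      trans (sumTo-last k short)
      (trans (cong₂ _+_ (sumTo-cong k (λ i i<k → cong (avoiders i *_) (short-term i i<k)))
                        (trans (cong (avoiders k *_) last-term) (*-zeroʳ (avoiders k))))
      (trans (+-identityʳ _)
             (sumTo-factorʳ k avoiders (λ i → a (k ∸ i)) (avoiders (suc t)))))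
    -- a block of k+1+j entries contributes exactly when mmp of the block is j
    long-term : ∀ j → j ≤ t → long j ≡ avoiders (suc k) * (avoiders j * avoiders (t ∸ j))
    long-term j j≤t =
      trans (cong (_* avoiders (t ∸ j)) (ΣAv-cong (suc k + j) (λ α w → cong ind
              (+-∸-≡ᵇ (mmp (suc k) α) j t (mmp-long-bound k j α w) j≤t))))
      (trans (cong (_* avoiders (t ∸ j)) (qcoeff-top (suc k) j))
             (*-assoc (avoiders (suc k)) (avoiders j) (avoiders (t ∸ j))))
    long-sum : sumTo (suc t) long ≡ avoiders (suc k) * avoiders (suc t)
    long-sum =
      trans (sumTo-cong (suc t) (λ j j< → long-term j (≤-pred j<)))
      (trans (sumTo-*ˡ (suc t) (λ j → avoiders j * avoiders (t ∸ j)) (avoiders (suc k)))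
             (cong (avoiders (suc k) *_) (sym (avoiders-segner t))))

Qcoeff-top : ∀ k n → k ≤ n → Qcoeff n k (n ∸ k) ≡ Cat k * Cat (n ∸ k)
Qcoeff-top k n k≤n =
  trans (Qcoeff≡qcoeff n k (n ∸ k))
  (trans (cong (λ l → qcoeff l k (n ∸ k)) (sym (m+[n∸m]≡n k≤n)))
  (trans (qcoeff-top k (n ∸ k))
         (cong₂ _*_ (avoiders≡Cat k) (avoiders≡Cat (n ∸ k)))))

recurrence-via-avoiders : (a : ℕ → ℕ) → a 1 ≡ 1 →
  ((k : ℕ) → 2 ≤ k → a k ≡ Cat k + sum (map (λ j → Cat j * a (k ∸ suc j)) (upTo (k ∸ 1)))) →
  ∀ k → a (suc k) ≡ avoiders (suc k) + sumTo k (λ i → avoiders i * a (k ∸ i))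
recurrence-via-avoiders a a1 a-rec zero = a1
recurrence-via-avoiders a a1 a-rec (suc k) =
  trans (a-rec (suc (suc k)) (s≤s (s≤s z≤n)))
  (cong₂ _+_ (sym (avoiders≡Cat (suc (suc k))))
             (trans (sum-map-upTo (suc k) (λ j → Cat j * a (suc k ∸ j)))
                    (sumTo-cong (suc k) (λ j _ → cong (_* a (suc k ∸ j)) (sym (avoiders≡Cat j))))))

Qcoeff-subtop : (a : ℕ → ℕ) → (∀ k → a (suc k) ≡ avoiders (suc k) + sumTo k (λ i → avoiders i * a (k ∸ i))) →
  ∀ k n → suc k + 1 ≤ n → Qcoeff n (suc k) (n ∸ suc k ∸ 1) ≡ a (suc k) * Cat (n ∸ suc k)
Qcoeff-subtop a a-rec k n k+2≤n =
  trans (Qcoeff≡qcoeff n (suc k) t)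
  (trans (cong (λ l → qcoeff l (suc k) t) (sym n≡))
  (trans (qcoeff-subtop a a-rec k t)
         (cong (a (suc k) *_) (trans (cong avoiders (sym u≡)) (avoiders≡Cat u)))))
  where
  u = n ∸ suc k
  t = u ∸ 1
  u≡ : u ≡ suc t
  u≡ = sym (m+[n∸m]≡n (subst (_≤ u) (m+n∸m≡n (suc k) 1) (∸-monoˡ-≤ (suc k) k+2≤n)))
  n≡ : suc k + suc t ≡ n
  n≡ = trans (cong (suc k +_) (sym u≡)) (m+[n∸m]≡n (≤-trans (m≤m+n (suc k) 1) k+2≤n))

theorem19 :
    ((k n : ℕ) → 1 ≤ k → k ≤ n →
      ((r : ℕ) → n ∸ k < r → Qcoeff n k r ≡ 0)
      × (0 < Qcoeff n k (n ∸ k))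
      × (Qcoeff n k (n ∸ k) ≡ Cat k * Cat (n ∸ k)))
    ×
    ((a : ℕ → ℕ) → a 1 ≡ 1 →
      ((k : ℕ) → 2 ≤ k →
        a k ≡ Cat k + sum (map (λ j → Cat j * a (k ∸ suc j)) (upTo (k ∸ 1)))) →
      (k n : ℕ) → 1 ≤ k → k + 1 ≤ n →
        Qcoeff n k (n ∸ k ∸ 1) ≡ a k * Cat (n ∸ k))
theorem19 = part1 , part2
  where
  part1 : (k n : ℕ) → 1 ≤ k → k ≤ n →
    ((r : ℕ) → n ∸ k < r → Qcoeff n k r ≡ 0)
    × (0 < Qcoeff n k (n ∸ k))
    × (Qcoeff n k (n ∸ k) ≡ Cat k * Cat (n ∸ k))
  part1 k n _ k≤n =
    (λ r n∸k<r → trans (Qcoeff≡qcoeff n k r) (qcoeff-vanish n k r n∸k<r)) ,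
    subst (0 <_) (sym (Qcoeff-top k n k≤n))
          (subst₂ (λ x y → 1 ≤ x * y) (avoiders≡Cat k) (avoiders≡Cat (n ∸ k))
                  (*-mono-≤ (avoiders-pos k) (avoiders-pos (n ∸ k)))) ,
    Qcoeff-top k n k≤n
  part2 : (a : ℕ → ℕ) → a 1 ≡ 1 →
    ((k : ℕ) → 2 ≤ k → a k ≡ Cat k + sum (map (λ j → Cat j * a (k ∸ suc j)) (upTo (k ∸ 1)))) →
    (k n : ℕ) → 1 ≤ k → k + 1 ≤ n → Qcoeff n k (n ∸ k ∸ 1) ≡ a k * Cat (n ∸ k)
  part2 a a1 a-rec (suc k) n _ = Qcoeff-subtop a (recurrence-via-avoiders a a1 a-rec) k n
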